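{- Let $n\ge 1$, $\mathcal I=\{1,\dots,n\}$, let $\mathcal X,\mathcal W$ and $\mathcal Y_i$ ($i\in\mathcal I$) be finite nonempty sets and $g:\mathcal W\times\mathcal X\to[0,1]$ a gain function. For any prior $\pi$ on $\mathcal X$ with $V_g(\pi)>0$ and any channels $(\mathcal X,\mathcal Y_i,C_i)$, $i\in\mathcal I$, $$I_g\bigl(\pi,\ \parallel_{i\in\mathcal I}C_i\bigr)\ \le\ \sum_{i\in\mathcal I}I_g(\pi,C_i)+(\#\mathcal I-1)\cdot\bigl(H_g^{\min}(\pi)-H_g(\pi)\bigr).$$
   Context: A (discrete) channel $(\mathcal X,\mathcal Y,C)$ consists of finite sets $\mathcal X,\mathcal Y$ and a matrix $C$ with entries $C[x,y]\ge 0$ and $\sum_{y}C[x,y]=1$ for each $x$. A prior on $\mathcal X$ is a probability distribution on $\mathcal X$. The $n$-ary parallel composition with shared input $\parallel_{i\in\mathcal I}C_i=C_1\parallel\cdots\parallel C_n$ is the channel from $\mathcal X$ to $\mathcal Y_1\times\cdots\times\mathcal Y_n$ whose entry at $(x,(y_1,\dots,y_n))$ is $\prod_i C_i[x,y_i]$. $V_g(\pi)=\max_{w\in\mathcal W}\sum_{x}\pi[x]g(w,x)$, $V_g(\pi,C)=\sum_{y}\max_{w\in\mathcal W}\sum_x\pi[x]C[x,y]g(w,x)$, $H_g(\pi)=-\log V_g(\pi)$, $H_g(\pi,C)=-\log V_g(\pi,C)$, and the $g$-leakage is $I_g(\pi,C)=H_g(\pi)-H_g(\pi,C)$. Logarithms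 are to base 2. $H_g^{\min}(\pi)=-\log\min\{\pi[x]g(w,x): x\in\mathcal X,\ w\in\mathcal W,\ \pi[x]g(w,x)\ne0\}$. -}

module Defs where

open import Level using (_⊔_) renaming (suc to lsuc)
open import Algebra.Bundles using (CommutativeRing; Semiring)
open import Data.Fin.Base using (Fin; zero; suc; combine; _↑ˡ_; _↑ʳ_)
open import Data.Fin.Properties using (*↔×; 1↔⊤; remQuot-combine)
open import Data.List.Base as List using (List; []; _∷_)
open import Data.Nat.Base as ℕ using (ℕ; zero; suc)
import Data.Nat.Properties as ℕ
open import Data.Product.Base using (Σ; ∃; _×_; _,_; proj₁; proj₂)
open import Data.Product.Function.NonDependent.Propositional using (_×-↔_)
open import Data.Sum.Base using (inj₁; inj₂)
open import Data.Unit.Base using (⊤)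
import Data.Vec.Functional as Vector
open import Function.Base using (_∘_)
open import Function.Bundles using (_↔_; Inverse)
open import Function.Construct.Composition using (_↔-∘_)
open import Relation.Binary.Bundles using (TotalOrder; Poset)
open import Relation.Binary.Core using (Rel)
open import Relation.Binary.PropositionalEquality.Core as ≡ using ()
open import Relation.Binary.Structures using (IsDecTotalOrder)
open import Relation.Nullary using (¬_; Dec; yes; no; ¬?; _×-dec_; contradiction)
open import Relation.Unary using (Pred)

------------------------------------------------------------------------
-- Ordered fields

record OrderedField c ℓ : Set (lsuc (c ⊔ ℓ)) where
  infix 4 _≤_
  field
    commutativeRing : CommutativeRing c ℓ

  open CommutativeRing commutativeRing public hiding (zero)

  field
    0≉1             : ¬ (0# ≈ 1#)
    inverse         : ∀ x → ¬ (x ≈ 0#) → ∃ λ y → x * y ≈ 1#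
    _≤_             : Rel Carrier ℓ
    isDecTotalOrder : IsDecTotalOrder _≈_ _≤_
    +-monoˡ-≤       : ∀ {x y} z → x ≤ y → x + z ≤ y + z
    *-nonneg        : ∀ {x y} → 0# ≤ x → 0# ≤ y → 0# ≤ x * y

  open IsDecTotalOrder isDecTotalOrder public
    using (_≟_; _≤?_; total; antisym; isTotalOrder)
    renaming (refl to ≤-refl; reflexive to ≤-reflexive; trans to ≤-trans)

  totalOrder : TotalOrder c ℓ ℓ
  totalOrder = record { isTotalOrder = isTotalOrder }

  infix 4 _<_ _<?_

  _<_ : Rel Carrier ℓ
  x < y = x ≤ y × ¬ (x ≈ y)

  _<?_ : ∀ x y → Dec (x < y)
  x <? y = (x ≤? y) ×-dec ¬? (x ≟ y)

  open import Algebra.Definitions.RawSemiring (Semiring.rawSemiring semiring) public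
    using (_^_; sum; product) renaming (_×_ to _×ℕ_)
  open import Algebra.Construct.NaturalChoice.Max totalOrder public
    using () renaming (_⊔_ to max)
  open import Algebra.Construct.NaturalChoice.Min totalOrder public
    using () renaming (_⊓_ to min)

module OrderedFieldProperties {c ℓ} (F : OrderedField c ℓ) where
  open OrderedField F

  poset : Poset c ℓ ℓ
  poset = TotalOrder.poset totalOrder

  open import Relation.Binary.Reasoning.PartialOrder poset
  open import Algebra.Properties.Ring ring using (-1*x≈-x; -‿involutive)

  +-monoʳ-≤ : ∀ {x y} z → x ≤ y → z + x ≤ z + y
  +-monoʳ-≤ {x} {y} z x≤y = begin
    z + x  ≈⟨ +-comm z x ⟩
    x + z  ≤⟨ +-monoˡ-≤ z x≤y ⟩
    y + z  ≈⟨ +-comm y z ⟩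
    z + y  ∎

  +-mono-≤ : ∀ {x y u v} → x ≤ y → u ≤ v → x + u ≤ y + v
  +-mono-≤ x≤y u≤v = ≤-trans (+-monoˡ-≤ _ x≤y) (+-monoʳ-≤ _ u≤v)

  cancel : ∀ x z → x + z + - z ≈ x
  cancel x z = trans (+-assoc x z (- z)) (trans (+-congˡ (-‿inverseʳ z)) (+-identityʳ x))

  +-cancelʳ-≤ : ∀ {x y} z → x + z ≤ y + z → x ≤ y
  +-cancelʳ-≤ {x} {y} z h = begin
    x            ≈⟨ cancel x z ⟨
    x + z + - z  ≤⟨ +-monoˡ-≤ (- z) h ⟩
    y + z + - z  ≈⟨ cancel y z ⟩
    y            ∎

  ≤⇒0≤- : ∀ {x y} → x ≤ y → 0# ≤ y + - x
  ≤⇒0≤- {x} {y} x≤y = begin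
    0#       ≈⟨ -‿inverseʳ x ⟨
    x + - x  ≤⟨ +-monoˡ-≤ (- x) x≤y ⟩
    y + - x  ∎

  *-monoʳ-≤ : ∀ {x y} z → 0# ≤ z → x ≤ y → z * x ≤ z * y
  *-monoʳ-≤ {x} {y} z 0≤z x≤y = begin
    z * x                  ≈⟨ +-identityˡ _ ⟨
    0# + z * x             ≤⟨ +-monoˡ-≤ _ (*-nonneg 0≤z (≤⇒0≤- x≤y)) ⟩
    z * (y + - x) + z * x  ≈⟨ distribˡ z _ _ ⟨
    z * (y + - x + x)      ≈⟨ *-congˡ (trans (+-assoc y (- x) x)
                                (trans (+-congˡ (-‿inverseˡ x)) (+-identityʳ y))) ⟩
    z * y                  ∎

  0≤1 : 0# ≤ 1#
  0≤1 with total 0# 1#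
  ... | inj₁ 0≤1 = 0≤1
  ... | inj₂ 1≤0 = begin
    0#             ≤⟨ *-nonneg 0≤-1 0≤-1 ⟩
    - 1# * - 1#    ≈⟨ -1*x≈-x (- 1#) ⟩
    - (- 1#)       ≈⟨ -‿involutive 1# ⟩
    1#             ∎
    where
    0≤-1 : 0# ≤ - 1#
    0≤-1 = ≤-trans (≤⇒0≤- 1≤0) (≤-reflexive (+-identityˡ (- 1#)))

------------------------------------------------------------------------
-- The real numbers, as an arbitrary Dedekind-complete ordered field.
--
-- The order is decidable, as it is classically for the reals; this is
-- what makes the minimum over the nonzero π[x]g(w,x) computable.
-- Classically `archimedean` follows from `supremum`; it is a separate
-- field because constructively completeness does not yield the witness.

record CompleteOrderedField c ℓ : Set (lsuc (c ⊔ ℓ)) where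
  field
    orderedField : OrderedField c ℓ

  open OrderedField orderedField public

  IsUpperBound : Pred Carrier ℓ → Carrier → Set (c ⊔ ℓ)
  IsUpperBound P u = ∀ x → P x → x ≤ u

  IsSupremum : Pred Carrier ℓ → Carrier → Set (c ⊔ ℓ)
  IsSupremum P s = IsUpperBound P s × (∀ u → IsUpperBound P u → s ≤ u)

  field
    supremum    : (P : Pred Carrier ℓ) → ∃ P → ∃ (IsUpperBound P) → ∃ (IsSupremum P)
    archimedean : ∀ x → ∃ λ n → x ≤ n ×ℕ 1#

------------------------------------------------------------------------
-- The binary logarithm

module Logarithm {c ℓ} (ℝ : CompleteOrderedField c ℓ) where
  open CompleteOrderedField ℝ
  open OrderedFieldProperties orderedField

  2# : Carrier
  2# = 1# + 1#

  -- r is a rational number (p - q) / (b + 1) with 2 ^ r ≤ x, the latter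
  -- being cleared of its negative and fractional exponents.
  RationalBelowLog₂ : Carrier → Pred Carrier ℓ
  RationalBelowLog₂ x r =
    Σ ℕ λ p → Σ ℕ λ q → Σ ℕ λ b →
      (suc b ×ℕ r + q ×ℕ 1# ≈ p ×ℕ 1#) × (2# ^ p ≤ 2# ^ q * x ^ suc b)

  private
    open import Relation.Binary.Reasoning.PartialOrder poset
    open import Algebra.Properties.Semiring.Mult semiring
      using (×-homo-+; ×-assocˡ)
    open import Algebra.Properties.CommutativeSemiring.Exp commutativeSemiring
      using (^-homo-*; ^-assocʳ)

  0≤2 : 0# ≤ 2#
  0≤2 = ≤-trans (≤-reflexive (sym (+-identityˡ 0#))) (+-mono-≤ 0≤1 0≤1)

  2*x : ∀ x → 2# * x ≈ x + x
  2*x x = trans (distribʳ x 1# 1#) (+-cong (*-identityˡ x) (*-identityˡ x))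

  ^-nonneg : ∀ {x} n → 0# ≤ x → 0# ≤ x ^ n
  ^-nonneg zero    0≤x = 0≤1
  ^-nonneg (suc n) 0≤x = *-nonneg 0≤x (^-nonneg n 0≤x)

  ^-monoˡ-≤ : ∀ {x y} n → 0# ≤ x → x ≤ y → x ^ n ≤ y ^ n
  ^-monoˡ-≤         zero    0≤x x≤y = ≤-refl
  ^-monoˡ-≤ {x} {y} (suc n) 0≤x x≤y = begin
    x * x ^ n  ≤⟨ *-monoʳ-≤ x 0≤x (^-monoˡ-≤ n 0≤x x≤y) ⟩
    x * y ^ n  ≈⟨ *-comm _ _ ⟩
    y ^ n * x  ≤⟨ *-monoʳ-≤ _ (^-nonneg n (≤-trans 0≤x x≤y)) x≤y ⟩
    y ^ n * y  ≈⟨ *-comm _ _ ⟩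
    y * y ^ n  ∎

  1≤2^ : ∀ n → 1# ≤ 2# ^ n
  1≤2^ zero    = ≤-refl
  1≤2^ (suc n) = begin
    1#                ≈⟨ +-identityʳ 1# ⟨
    1# + 0#           ≤⟨ +-mono-≤ (1≤2^ n) (^-nonneg n 0≤2) ⟩
    2# ^ n + 2# ^ n   ≈⟨ 2*x _ ⟨
    2# ^ suc n        ∎

  n≤2^n : ∀ n → n ×ℕ 1# ≤ 2# ^ n
  n≤2^n zero    = 0≤1
  n≤2^n (suc n) = begin
    1# + n ×ℕ 1#     ≤⟨ +-mono-≤ (1≤2^ n) (n≤2^n n) ⟩
    2# ^ n + 2# ^ n  ≈⟨ 2*x _ ⟨
    2# ^ suc n       ∎

  2^-bound : ∀ x → ∃ λ n → x ≤ 2# ^ n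
  2^-bound x with archimedean x
  ... | n , x≤n = n , ≤-trans x≤n (n≤2^n n)

  2^-cancel-≤ : ∀ m n → 2# ^ m ≤ 2# ^ n → m ℕ.≤ n
  2^-cancel-≤ zero    n       h = ℕ.z≤n
  2^-cancel-≤ (suc m) zero    h = contradiction (antisym 0≤1 1≤0) 0≉1
    where
    1≤0 : 1# ≤ 0#
    1≤0 = +-cancelʳ-≤ 1# (begin
      1# + 1#          ≤⟨ +-mono-≤ (1≤2^ m) (1≤2^ m) ⟩
      2# ^ m + 2# ^ m  ≈⟨ 2*x _ ⟨
      2# ^ suc m       ≤⟨ h ⟩
      1#               ≈⟨ +-identityˡ 1# ⟨
      0# + 1#          ∎)
  2^-cancel-≤ (suc m) (suc n) h with total (2# ^ m) (2# ^ n)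
  ... | inj₁ le = ℕ.s≤s (2^-cancel-≤ m n le)
  ... | inj₂ ge = ℕ.s≤s (2^-cancel-≤ m n (+-cancelʳ-≤ (2# ^ m) (begin
    2# ^ m + 2# ^ m  ≈⟨ 2*x _ ⟨
    2# ^ suc m       ≤⟨ h ⟩
    2# ^ suc n       ≈⟨ 2*x _ ⟩
    2# ^ n + 2# ^ n  ≤⟨ +-monoʳ-≤ _ ge ⟩
    2# ^ n + 2# ^ m  ∎)))

  ×ℕ-monoʳ-≤ : ∀ n {x y} → x ≤ y → n ×ℕ x ≤ n ×ℕ y
  ×ℕ-monoʳ-≤ zero    x≤y = ≤-refl
  ×ℕ-monoʳ-≤ (suc n) x≤y = +-mono-≤ x≤y (×ℕ-monoʳ-≤ n x≤y)

  ×ℕ1-mono-≤ : ∀ {m n} → m ℕ.≤ n → m ×ℕ 1# ≤ n ×ℕ 1#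
  ×ℕ1-mono-≤ {n = zero}  ℕ.z≤n     = ≤-refl
  ×ℕ1-mono-≤ {n = suc n} ℕ.z≤n     =
    ≤-trans (≤-reflexive (sym (+-identityˡ 0#))) (+-mono-≤ 0≤1 (×ℕ1-mono-≤ {n = n} ℕ.z≤n))
  ×ℕ1-mono-≤             (ℕ.s≤s h) = +-monoʳ-≤ 1# (×ℕ1-mono-≤ h)

  ×ℕ-cancelˡ-≤ : ∀ b {x y} → suc b ×ℕ x ≤ suc b ×ℕ y → x ≤ y
  ×ℕ-cancelˡ-≤ b {x} {y} h with total x y
  ... | inj₁ x≤y = x≤y
  ... | inj₂ y≤x = +-cancelʳ-≤ (b ×ℕ x) (≤-trans h (+-monoʳ-≤ y (×ℕ-monoʳ-≤ b y≤x)))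

  log₂-nonempty : ∀ {x} → 0# < x → ∃ (RationalBelowLog₂ x)
  log₂-nonempty {x} (0≤x , 0≉x)
    with y , xy≈1 ← inverse x (λ x≈0 → 0≉x (sym x≈0))
    with n , y≤2^n ← 2^-bound y
    = - (n ×ℕ 1#) , 0 , n , 0
    , trans (+-congʳ (+-identityʳ _)) (-‿inverseˡ _)
    , (begin
        1#               ≈⟨ xy≈1 ⟨
        x * y            ≤⟨ *-monoʳ-≤ x 0≤x y≤2^n ⟩
        x * 2# ^ n       ≈⟨ *-comm _ _ ⟩
        2# ^ n * x       ≈⟨ *-congˡ (*-identityʳ x) ⟨
        2# ^ n * x ^ 1   ∎)

  log₂-bounded : ∀ {x} → 0# < x → ∃ (IsUpperBound (RationalBelowLog₂ x))
  log₂-bounded {x} (0≤x , _) with n , x≤2^n ← 2^-bound x = n ×ℕ 1# , bound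
    where
    bound : IsUpperBound (RationalBelowLog₂ x) (n ×ℕ 1#)
    bound r (p , q , b , r≈ , 2^p≤) = ×ℕ-cancelˡ-≤ b (+-cancelʳ-≤ (q ×ℕ 1#) (begin
      suc b ×ℕ r + q ×ℕ 1#             ≈⟨ r≈ ⟩
      p ×ℕ 1#                          ≤⟨ ×ℕ1-mono-≤ p≤ ⟩
      (suc b ℕ.* n ℕ.+ q) ×ℕ 1#        ≈⟨ ×-homo-+ 1# (suc b ℕ.* n) q ⟩
      (suc b ℕ.* n) ×ℕ 1# + q ×ℕ 1#    ≈⟨ +-congʳ (×-assocˡ 1# (suc b) n) ⟨
      suc b ×ℕ n ×ℕ 1# + q ×ℕ 1#       ∎))
      where
      p≤ : p ℕ.≤ suc b ℕ.* n ℕ.+ q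
      p≤ = 2^-cancel-≤ p _ (begin
        2# ^ p                             ≤⟨ 2^p≤ ⟩
        2# ^ q * x ^ suc b                 ≤⟨ *-monoʳ-≤ _ (^-nonneg q 0≤2) (^-monoˡ-≤ (suc b) 0≤x x≤2^n) ⟩
        2# ^ q * (2# ^ n) ^ suc b          ≈⟨ *-congˡ (^-assocʳ 2# n (suc b)) ⟩
        2# ^ q * 2# ^ (n ℕ.* suc b)        ≈⟨ *-comm _ _ ⟩
        2# ^ (n ℕ.* suc b) * 2# ^ q        ≈⟨ ^-homo-* 2# (n ℕ.* suc b) q ⟨
        2# ^ (n ℕ.* suc b ℕ.+ q)           ≡⟨ ≡.cong (λ k → 2# ^ (k ℕ.+ q)) (ℕ.*-comm n (suc b)) ⟩
        2# ^ (suc b ℕ.* n ℕ.+ q)           ∎)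

  -- log₂ x = sup { r rational ∣ 2 ^ r ≤ x } for positive x; at other
  -- arguments the value 0# is a convention.
  log₂ : Carrier → Carrier
  log₂ x with 0# <? x
  ... | yes 0<x = proj₁ (supremum (RationalBelowLog₂ x) (log₂-nonempty 0<x) (log₂-bounded 0<x))
  ... | no  _   = 0#

------------------------------------------------------------------------
-- Finite nonempty sets

record FiniteSet : Set₁ where
  field
    Element  : Set
    predSize : ℕ
    enum     : Fin (suc predSize) ↔ Element

open FiniteSet public using (Element)

infixr 2 _×ᶠ_

_×ᶠ_ : FiniteSet → FiniteSet → FiniteSet
A ×ᶠ B = record
  { Element  = Element A × Element B
  ; predSize = FiniteSet.predSize B ℕ.+ FiniteSet.predSize A ℕ.* suc (FiniteSet.predSize B)
  ; enum     = (FiniteSet.enum A ×-↔ FiniteSet.enum B)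
               ↔-∘ *↔× {suc (FiniteSet.predSize A)} {suc (FiniteSet.predSize B)}
  }

-- Πᶠ Y is Y₁ × ⋯ × Yₙ, a tuple being right-nested and ended by tt.
Πᶠ : ∀ {n} → (Fin n → FiniteSet) → FiniteSet
Πᶠ {zero}  Y = record { Element = ⊤ ; predSize = 0 ; enum = 1↔⊤ }
Πᶠ {suc n} Y = Y zero ×ᶠ Πᶠ (Y ∘ suc)

component : ∀ {n} {Y : Fin n → FiniteSet} → Element (Πᶠ Y) → (i : Fin n) → Element (Y i)
component (y , _)  zero    = y
component (_ , ys) (suc i) = component ys i

------------------------------------------------------------------------
-- Channels and g-leakage

module Leakage {c ℓ} (ℝ : CompleteOrderedField c ℓ) where
  open CompleteOrderedField ℝ
  open OrderedFieldProperties orderedField using (0≤1)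
  open Logarithm ℝ using (log₂)

  _at_ : (A : FiniteSet) → Fin (suc (FiniteSet.predSize A)) → Element A
  A at i = Inverse.to (FiniteSet.enum A) i

  sumOver : (A : FiniteSet) → (Element A → Carrier) → Carrier
  sumOver A f = sum λ i → f (A at i)

  syntax sumOver A (λ x → e) = ∑[ x ∈ A ] e

  maxOver : (A : FiniteSet) → (Element A → Carrier) → Carrier
  maxOver A f = Vector.foldr max (f (A at zero)) λ i → f (A at suc i)

  syntax maxOver A (λ x → e) = max[ x ∈ A ] e

  elements : (A : FiniteSet) → List (Element A)
  elements A = List.tabulate (A at_)

  minimum : List Carrier → Carrier
  minimum []       = 0#   -- convention; the minimum is meant for nonempty lists
  minimum (x ∷ xs) = List.foldr min x xs

  record Prior (X : FiniteSet) : Set (c ⊔ ℓ) where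
    field
      prob       : Element X → Carrier
      nonneg     : ∀ x → 0# ≤ prob x
      normalised : ∑[ x ∈ X ] prob x ≈ 1#

  record Channel (X Y : FiniteSet) : Set (c ⊔ ℓ) where
    field
      entry      : Element X → Element Y → Carrier
      nonneg     : ∀ x y → 0# ≤ entry x y
      normalised : ∀ x → ∑[ y ∈ Y ] entry x y ≈ 1#

  record GainFunction (W X : FiniteSet) : Set (c ⊔ ℓ) where
    field
      gain   : Element W → Element X → Carrier
      nonneg : ∀ w x → 0# ≤ gain w x
      ≤1     : ∀ w x → gain w x ≤ 1#

  open Prior
  open Channel
  open GainFunction

  private
    open import Relation.Binary.Reasoning.Setoid setoid
    open import Algebra.Properties.Semiring.Sum semiring
      using (sum-cong-≋; *-distribˡ-sum)

  sum-++ : ∀ m n (h : Fin (m ℕ.+ n) → Carrier) →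
           sum h ≈ sum {m} (λ i → h (i ↑ˡ n)) + sum {n} (λ j → h (m ↑ʳ j))
  sum-++ zero    n h = sym (+-identityˡ _)
  sum-++ (suc m) n h = trans (+-congˡ (sum-++ m n (h ∘ suc))) (sym (+-assoc _ _ _))

  sum-combine : ∀ m n (h : Fin (m ℕ.* n) → Carrier) →
                sum h ≈ sum {m} (λ i → sum {n} (λ j → h (combine i j)))
  sum-combine zero    n h = refl
  sum-combine (suc m) n h =
    trans (sum-++ n (m ℕ.* n) h) (+-congˡ (sum-combine m n (h ∘ (n ↑ʳ_))))

  sumOver-cong : ∀ A {f h : Element A → Carrier} → (∀ a → f a ≈ h a) → sumOver A f ≈ sumOver A h
  sumOver-cong A f≈h = sum-cong-≋ (λ i → f≈h (A at i))

  *-distribˡ-sumOver : ∀ A x (f : Element A → Carrier) → x * sumOver A f ≈ ∑[ a ∈ A ] (x * f a)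
  *-distribˡ-sumOver A x f = *-distribˡ-sum x (λ i → f (A at i))

  sumOver-× : ∀ A B (f : Element A × Element B → Carrier) →
              (∑[ z ∈ (A ×ᶠ B) ] f z) ≈ ∑[ a ∈ A ] ∑[ b ∈ B ] f (a , b)
  sumOver-× A B f = trans (sum-combine m n h)
    (sum-cong-≋ λ i → sum-cong-≋ λ j → reflexive
      (≡.cong (λ z → f (A at proj₁ z , B at proj₂ z)) (remQuot-combine {m} {n} i j)))
    where
    m = suc (FiniteSet.predSize A)
    n = suc (FiniteSet.predSize B)
    h : Fin (m ℕ.* n) → Carrier
    h k = f ((A ×ᶠ B) at k)

  product-nonneg : ∀ {n} (f : Fin n → Carrier) → (∀ i → 0# ≤ f i) → 0# ≤ product f
  product-nonneg {zero}  f 0≤f = 0≤1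
  product-nonneg {suc n} f 0≤f = *-nonneg (0≤f zero) (product-nonneg (f ∘ suc) (0≤f ∘ suc))

  parallelEntry : ∀ {n X} {Y : Fin n → FiniteSet} → (∀ i → Channel X (Y i)) →
                  Element X → Element (Πᶠ Y) → Carrier
  parallelEntry C x ys = product λ i → entry (C i) x (component ys i)

  parallel-normalised : ∀ {n X} {Y : Fin n → FiniteSet} (C : ∀ i → Channel X (Y i)) x →
                        (∑[ ys ∈ Πᶠ Y ] parallelEntry C x ys) ≈ 1#
  parallel-normalised {zero}          C x = +-identityʳ 1#
  parallel-normalised {suc n} {Y = Y} C x = begin
    (∑[ ys ∈ Πᶠ Y ] parallelEntry C x ys)
      ≈⟨ sumOver-× (Y zero) (Πᶠ (Y ∘ suc)) (parallelEntry C x) ⟩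
    (∑[ y ∈ Y zero ] ∑[ ys ∈ Πᶠ (Y ∘ suc) ] (entry (C zero) x y * parallelEntry (C ∘ suc) x ys))
      ≈⟨ sumOver-cong (Y zero) (λ y →
           *-distribˡ-sumOver (Πᶠ (Y ∘ suc)) (entry (C zero) x y) (parallelEntry (C ∘ suc) x)) ⟨
    (∑[ y ∈ Y zero ] (entry (C zero) x y * ∑[ ys ∈ Πᶠ (Y ∘ suc) ] parallelEntry (C ∘ suc) x ys))
      ≈⟨ sumOver-cong (Y zero) {h = entry (C zero) x} (λ y →
           trans (*-congˡ (parallel-normalised (C ∘ suc) x)) (*-identityʳ _)) ⟩
    (∑[ y ∈ Y zero ] entry (C zero) x y)
      ≈⟨ normalised (C zero) x ⟩
    1# ∎

  ∥_ : ∀ {n X} {Y : Fin n → FiniteSet} → (∀ i → Channel X (Y i)) → Channel X (Πᶠ Y)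
  ∥ C = record
    { entry      = parallelEntry C
    ; nonneg     = λ x ys → product-nonneg _ λ i → nonneg (C i) x (component ys i)
    ; normalised = parallel-normalised C
    }

  module _ {W X : FiniteSet} (g : GainFunction W X) (π : Prior X) where

    V : Carrier
    V = max[ w ∈ W ] ∑[ x ∈ X ] (prob π x * gain g w x)

    H : Carrier
    H = - log₂ V

    Hᵐⁱⁿ : Carrier
    Hᵐⁱⁿ = - log₂ (minimum (List.filter (λ v → ¬? (v ≟ 0#))
      (List.cartesianProductWith (λ x w → prob π x * gain g w x) (elements X) (elements W))))

    module _ {Y : FiniteSet} (C : Channel X Y) where

      posteriorV : Carrier
      posteriorV = ∑[ y ∈ Y ] max[ w ∈ W ] ∑[ x ∈ X ] (prob π x * entry C x y * gain g w x)

      posteriorH : Carrier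
      posteriorH = - log₂ posteriorV

      I : Carrier
      I = H - posteriorH

{-# OPTIONS --safe #-}

-- Write a(w,x) = π[x]g(w,x), let μ be the least nonzero a(w,x), and let C ∥ D be
-- the composition of two channels.  Since a = 0 or μ ≤ a, one has μ a ≤ a², hence
--   μ Σₓ a(w,x) C[x,y] D[x,z] ≤ Σₓ (a C)(a D) ≤ (Σₓ a(w,x) C[x,y]) (Σₓ a(w,x) D[x,z]).
-- Maximising over w and summing over y and z gives μ V(π, C ∥ D) ≤ V(π,C) V(π,D),
-- and taking logarithms
--   I(π, C ∥ D) ≤ I(π,C) + I(π,D) + (Hᵐⁱⁿ(π) − H(π)).
-- The case of n channels follows by induction.

module Submission where

open import Defs
open import Data.Nat.Base as ℕ using (ℕ; zero; suc; pred; NonZero)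
import Data.Nat.Properties as ℕ
open import Data.Fin.Base using (Fin; zero; suc)
open import Data.List.Base as List using (List; []; _∷_)
open import Data.List.Membership.Propositional using (_∈_)
open import Data.List.Membership.Propositional.Properties
  using (∈-tabulate⁺; ∈-cartesianProductWith⁺; ∈-cartesianProductWith⁻; ∈-filter⁺; ∈-filter⁻)
open import Data.List.Relation.Unary.Any using (here; there)
open import Data.Product.Base using (∃; _×_; _,_; proj₁; proj₂)
open import Data.Sum.Base using (_⊎_; inj₁; inj₂)
open import Data.Unit.Base using (tt)
import Data.Vec.Functional as Vector
open import Function.Base using (_∘_)
open import Function.Bundles using (Inverse)
open import Relation.Binary.PropositionalEquality.Core as ≡ using (_≡_)
open import Relation.Nullary using (¬_; yes; no; ¬?; contradiction)

-- Inequalities in an ordered field.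

module Order {c ℓ} (F : OrderedField c ℓ) where
  open OrderedField F
  open OrderedFieldProperties F
  open import Relation.Binary.Reasoning.PartialOrder poset
  open import Algebra.Properties.CommutativeSemigroup *-commutativeSemigroup public
    using () renaming (interchange to *-interchange)
  open import Algebra.Properties.CommutativeSemigroup +-commutativeSemigroup public
    using () renaming (interchange to +-interchange)

  0<-respʳ-≈ : ∀ {x y} → x ≈ y → 0# < x → 0# < y
  0<-respʳ-≈ x≈y (0≤x , 0≉x) =
    ≤-trans 0≤x (≤-reflexive x≈y) , λ 0≈y → 0≉x (trans 0≈y (sym x≈y))

  0<-≤-trans : ∀ {x y} → 0# < x → x ≤ y → 0# < y
  0<-≤-trans (0≤x , 0≉x) x≤y =
    ≤-trans 0≤x x≤y , λ 0≈y → 0≉x (antisym 0≤x (≤-trans x≤y (≤-reflexive (sym 0≈y))))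

  *-monoˡ-≤ : ∀ {x y} z → 0# ≤ z → x ≤ y → x * z ≤ y * z
  *-monoˡ-≤ {x} {y} z 0≤z x≤y = begin
    x * z  ≈⟨ *-comm x z ⟩
    z * x  ≤⟨ *-monoʳ-≤ z 0≤z x≤y ⟩
    z * y  ≈⟨ *-comm z y ⟩
    y * z  ∎

  *-mono-≤ : ∀ {x y u v} → 0# ≤ u → 0# ≤ y → x ≤ y → u ≤ v → x * u ≤ y * v
  *-mono-≤ 0≤u 0≤y x≤y u≤v = ≤-trans (*-monoˡ-≤ _ 0≤u x≤y) (*-monoʳ-≤ _ 0≤y u≤v)

  +-nonneg : ∀ {x y} → 0# ≤ x → 0# ≤ y → 0# ≤ x + y
  +-nonneg {x} {y} 0≤x 0≤y = begin
    0#       ≈⟨ +-identityˡ 0# ⟨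
    0# + 0#  ≤⟨ +-mono-≤ 0≤x 0≤y ⟩
    x + y    ∎

  x≤x+y : ∀ {x y} → 0# ≤ y → x ≤ x + y
  x≤x+y {x} {y} 0≤y = begin
    x       ≈⟨ +-identityʳ x ⟨
    x + 0#  ≤⟨ +-monoʳ-≤ x 0≤y ⟩
    x + y   ∎

  y≤x+y : ∀ {x y} → 0# ≤ x → y ≤ x + y
  y≤x+y {x} {y} 0≤x = ≤-trans (x≤x+y 0≤x) (≤-reflexive (+-comm y x))

  x+y≈0⇒x≈0 : ∀ {x y} → 0# ≤ x → 0# ≤ y → x + y ≈ 0# → x ≈ 0#
  x+y≈0⇒x≈0 0≤x 0≤y x+y≈0 = antisym (≤-trans (x≤x+y 0≤y) (≤-reflexive x+y≈0)) 0≤x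

  *-pos : ∀ {x y} → 0# < x → 0# < y → 0# < x * y
  *-pos {x} {y} (0≤x , 0≉x) (0≤y , 0≉y) = *-nonneg 0≤x 0≤y , λ 0≈xy → 0≉y (begin-equality
    0#           ≈⟨ zeroʳ x⁻¹ ⟨
    x⁻¹ * 0#     ≈⟨ *-congˡ 0≈xy ⟩
    x⁻¹ * (x * y)  ≈⟨ *-assoc x⁻¹ x y ⟨
    x⁻¹ * x * y  ≈⟨ *-congʳ (trans (*-comm x⁻¹ x) xx⁻¹≈1) ⟩
    1# * y       ≈⟨ *-identityˡ y ⟩
    y            ∎)
    where
    x⁻¹,xx⁻¹≈1 = inverse x (λ x≈0 → 0≉x (sym x≈0))
    x⁻¹ = proj₁ x⁻¹,xx⁻¹≈1
    xx⁻¹≈1 = proj₂ x⁻¹,xx⁻¹≈1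

  x-y+y≈x : ∀ x y → x - y + y ≈ x
  x-y+y≈x x y = begin-equality
    x - y + y      ≈⟨ +-assoc x (- y) y ⟩
    x + (- y + y)  ≈⟨ +-congˡ (-‿inverseˡ y) ⟩
    x + 0#         ≈⟨ +-identityʳ x ⟩
    x              ∎

  [x-y]+[y-z]≈x-z : ∀ x y z → (x - y) + (y - z) ≈ x - z
  [x-y]+[y-z]≈x-z x y z = trans (sym (+-assoc (x - y) y (- z))) (+-congʳ (x-y+y≈x x y))

-- The binary logarithm is monotone and turns products into sums.

module LogarithmProperties {c ℓ} (ℝ : CompleteOrderedField c ℓ) where
  open CompleteOrderedField ℝ
  open OrderedFieldProperties orderedField
  open Order orderedField
  open Logarithm ℝ
  open import Relation.Binary.Reasoning.PartialOrder poset
  open import Algebra.Properties.Semiring.Mult semiring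
    using (×-homo-+; ×-assocˡ; ×-assoc-*; ×-comm-*; ×-congʳ)
  open import Algebra.Properties.CommutativeMonoid.Mult +-commutativeMonoid
    using (×-distrib-+)
  open import Algebra.Properties.CommutativeSemiring.Exp commutativeSemiring
    using (^-homo-*; ^-assocʳ; ^-distrib-*)

  ×ℕ-comm : ∀ m n x → m ×ℕ (n ×ℕ x) ≈ n ×ℕ (m ×ℕ x)
  ×ℕ-comm m n x = begin-equality
    m ×ℕ (n ×ℕ x)   ≈⟨ ×-assocˡ x m n ⟩
    (m ℕ.* n) ×ℕ x  ≡⟨ ≡.cong (_×ℕ x) (ℕ.*-comm m n) ⟩
    (n ℕ.* m) ×ℕ x  ≈⟨ ×-assocˡ x n m ⟨
    n ×ℕ (m ×ℕ x)   ∎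

  ×ℕ-divisible : ∀ b t → ∃ λ r → suc b ×ℕ r ≈ t
  ×ℕ-divisible b t = proj₁ inv * t , (begin-equality
    suc b ×ℕ (proj₁ inv * t)       ≈⟨ ×-assoc-* (suc b) (proj₁ inv) t ⟨
    (suc b ×ℕ proj₁ inv) * t       ≈⟨ *-congʳ (×-congʳ (suc b) (*-identityˡ _)) ⟨
    (suc b ×ℕ (1# * proj₁ inv)) * t  ≈⟨ *-congʳ (×-assoc-* (suc b) 1# _) ⟨
    ((suc b ×ℕ 1#) * proj₁ inv) * t  ≈⟨ *-congʳ (proj₂ inv) ⟩
    1# * t                         ≈⟨ *-identityˡ t ⟩
    t                              ∎)
    where
    -- Characteristic zero: `b ×ℕ 1#` is nonnegative, so if `1# + b ×ℕ 1#` vanished, `1#` would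
    -- vanish too.
    inv = inverse (suc b ×ℕ 1#) λ 1+b≈0 →
      0≉1 (sym (x+y≈0⇒x≈0 0≤1 (×ℕ1-mono-≤ {0} {b} ℕ.z≤n) 1+b≈0))

  -- An error that stays bounded while the multiple grows is zero after division. This allows
  -- logarithms to be compared through estimates that are only exact up to two units.
  ×ℕ-≤-archimedean : ∀ {x y} → (∀ b → suc b ×ℕ x ≤ suc b ×ℕ y + 2#) → x ≤ y
  ×ℕ-≤-archimedean {x} {y} h with total x y
  ... | inj₁ x≤y = x≤y
  ... | inj₂ y≤x with x - y ≟ 0#
  ...   | yes d≈0 = begin
    x          ≈⟨ x-y+y≈x x y ⟨
    x - y + y  ≈⟨ +-congʳ d≈0 ⟩
    0# + y     ≈⟨ +-identityˡ y ⟩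
    y          ∎
  ...   | no d≉0
    with d⁻¹ , dd⁻¹≈1 ← inverse (x - y) d≉0
    with n , d⁻¹≤n ← archimedean d⁻¹ = begin
      x          ≈⟨ x-y+y≈x x y ⟨
      d + y      ≤⟨ +-monoˡ-≤ y d≤0 ⟩
      0# + y     ≈⟨ +-identityˡ y ⟩
      y          ∎
      where
      d = x - y
      1≤nd : 1# ≤ n ×ℕ d
      1≤nd = begin
        1#             ≈⟨ dd⁻¹≈1 ⟨
        d * d⁻¹        ≤⟨ *-monoʳ-≤ d (≤⇒0≤- y≤x) d⁻¹≤n ⟩
        d * (n ×ℕ 1#)  ≈⟨ ×-comm-* n d 1# ⟩
        n ×ℕ (d * 1#)  ≈⟨ ×-congʳ n (*-identityʳ d) ⟩
        n ×ℕ d         ∎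
      -- Of the 2n + 1 copies of `d`, two batches of n copies are each at least `1#` and use up the
      -- error `2#`; the remaining copy must then be at most `0#`.
      N = suc (n ℕ.+ n)
      d≤0 : d ≤ 0#
      d≤0 = +-cancelʳ-≤ 2# (+-cancelʳ-≤ (N ×ℕ y) (begin
        d + 2# + N ×ℕ y                ≤⟨ +-monoˡ-≤ _ (+-monoʳ-≤ d (+-mono-≤ 1≤nd 1≤nd)) ⟩
        d + (n ×ℕ d + n ×ℕ d) + N ×ℕ y ≈⟨ +-congʳ (+-congˡ (×-homo-+ d n n)) ⟨
        N ×ℕ d + N ×ℕ y                ≈⟨ ×-distrib-+ d y N ⟨
        N ×ℕ (d + y)                   ≈⟨ ×-congʳ N (x-y+y≈x x y) ⟩
        N ×ℕ x                         ≤⟨ h (n ℕ.+ n) ⟩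
        N ×ℕ y + 2#                    ≈⟨ +-comm _ _ ⟩
        2# + N ×ℕ y                    ≈⟨ +-congʳ (+-identityˡ 2#) ⟨
        0# + 2# + N ×ℕ y               ∎))

  -- The case split repeats the one in the definition of `log₂`; positivity rules out the branch
  -- with the conventional value `0#`.
  log₂-isSupremum : ∀ {x} → 0# < x → IsSupremum (RationalBelowLog₂ x) (log₂ x)
  log₂-isSupremum {x} 0<x with 0# <? x
  ... | yes 0<x′ = proj₂ (supremum (RationalBelowLog₂ x) (log₂-nonempty 0<x′) (log₂-bounded 0<x′))
  ... | no  0≮x  = contradiction 0<x 0≮x

  -- Every rational below the logarithm of `x` is also below that of `y`, with the same p, q and b,
  -- so `log₂ y` is an upper bound for the set whose supremum is `log₂ x`.
  log₂-mono-≤ : ∀ {x y} → 0# < x → x ≤ y → log₂ x ≤ log₂ y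
  log₂-mono-≤ {x} {y} 0<x x≤y = proj₂ (log₂-isSupremum 0<x) (log₂ y)
    λ { r (p , q , b , r≈ , 2^p≤) → proj₁ (log₂-isSupremum (0<-≤-trans 0<x x≤y)) r
      ( p , q , b , r≈
      , ≤-trans 2^p≤ (*-monoʳ-≤ _ (^-nonneg q 0≤2) (^-monoˡ-≤ (suc b) (proj₁ 0<x) x≤y))) }

  -- The witness is (p - q) / (b + 1), in the cleared form that `RationalBelowLog₂` asks for.
  rational : ∀ b p q → ∃ λ r → suc b ×ℕ r + q ×ℕ 1# ≈ p ×ℕ 1#
  rational b p q with r , r≈ ← ×ℕ-divisible b (p ×ℕ 1# - q ×ℕ 1#) =
    r , trans (+-congʳ r≈) (x-y+y≈x _ _)

  -- The hypothesis makes (p - q) / (b + 1) a member of the set whose supremum is `log₂ x`.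
  log₂-lower : ∀ {x} b p q → 0# < x → 2# ^ p ≤ 2# ^ q * x ^ suc b →
               p ×ℕ 1# ≤ suc b ×ℕ log₂ x + q ×ℕ 1#
  log₂-lower {x} b p q 0<x 2^p≤ with r , r≈ ← rational b p q = begin
    p ×ℕ 1#                      ≈⟨ r≈ ⟨
    suc b ×ℕ r + q ×ℕ 1#         ≤⟨ +-monoˡ-≤ _ (×ℕ-monoʳ-≤ (suc b) r≤) ⟩
    suc b ×ℕ log₂ x + q ×ℕ 1#    ∎
    where
    r≤ = proj₁ (log₂-isSupremum 0<x) r (p , q , b , r≈ , 2^p≤)

  -- It suffices that r = (p - q) / N bounds every member r′ = (p′ - q′) / N′ of the set. Raise the
  -- inequality for r′ to the power N and the one for r to the power N′: both then contain x to the
  -- power N N′, which is eliminated, and the exponents of two can be compared.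
  log₂-upper : ∀ {x} b p q → 0# < x → 2# ^ q * x ^ suc b ≤ 2# ^ p →
               suc b ×ℕ log₂ x + q ×ℕ 1# ≤ p ×ℕ 1#
  log₂-upper {x} b p q 0<x ≤2^p with r , r≈ ← rational b p q = begin
    suc b ×ℕ log₂ x + q ×ℕ 1#    ≤⟨ +-monoˡ-≤ _ (×ℕ-monoʳ-≤ (suc b) (proj₂ (log₂-isSupremum 0<x) r bound)) ⟩
    suc b ×ℕ r + q ×ℕ 1#         ≈⟨ r≈ ⟩
    p ×ℕ 1#                      ∎
    where
    N = suc b
    bound : IsUpperBound (RationalBelowLog₂ x) r
    bound r′ (p′ , q′ , b′ , r′≈ , 2^p′≤) =
      ×ℕ-cancelˡ-≤ b′ (×ℕ-cancelˡ-≤ b (+-cancelʳ-≤ (k ×ℕ 1#) (begin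
        N ×ℕ (N′ ×ℕ r′) + k ×ℕ 1#
          ≈⟨ +-congˡ (×-homo-+ 1# (N ℕ.* q′) (N′ ℕ.* q)) ⟩
        N ×ℕ (N′ ×ℕ r′) + ((N ℕ.* q′) ×ℕ 1# + (N′ ℕ.* q) ×ℕ 1#)
          ≈⟨ +-assoc _ _ _ ⟨
        N ×ℕ (N′ ×ℕ r′) + (N ℕ.* q′) ×ℕ 1# + (N′ ℕ.* q) ×ℕ 1#
          ≈⟨ +-congʳ (clear N N′ r′ p′ q′ r′≈) ⟩
        (N ℕ.* p′) ×ℕ 1# + (N′ ℕ.* q) ×ℕ 1#
          ≈⟨ ×-homo-+ 1# (N ℕ.* p′) (N′ ℕ.* q) ⟨
        (N ℕ.* p′ ℕ.+ N′ ℕ.* q) ×ℕ 1#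
          ≤⟨ ×ℕ1-mono-≤ (2^-cancel-≤ (N ℕ.* p′ ℕ.+ N′ ℕ.* q) (N ℕ.* q′ ℕ.+ N′ ℕ.* p) exponents) ⟩
        (N ℕ.* q′ ℕ.+ N′ ℕ.* p) ×ℕ 1#
          ≈⟨ ×-homo-+ 1# (N ℕ.* q′) (N′ ℕ.* p) ⟩
        (N ℕ.* q′) ×ℕ 1# + (N′ ℕ.* p) ×ℕ 1#
          ≈⟨ +-congˡ (clear N′ N r p q r≈) ⟨
        (N ℕ.* q′) ×ℕ 1# + (N′ ×ℕ (N ×ℕ r) + (N′ ℕ.* q) ×ℕ 1#)
          ≈⟨ +-assoc _ _ _ ⟨
        (N ℕ.* q′) ×ℕ 1# + N′ ×ℕ (N ×ℕ r) + (N′ ℕ.* q) ×ℕ 1#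
          ≈⟨ +-congʳ (trans (+-comm _ _) (+-congʳ (×ℕ-comm N′ N r))) ⟩
        N ×ℕ (N′ ×ℕ r) + (N ℕ.* q′) ×ℕ 1# + (N′ ℕ.* q) ×ℕ 1#
          ≈⟨ +-assoc _ _ _ ⟩
        N ×ℕ (N′ ×ℕ r) + ((N ℕ.* q′) ×ℕ 1# + (N′ ℕ.* q) ×ℕ 1#)
          ≈⟨ +-congˡ (×-homo-+ 1# (N ℕ.* q′) (N′ ℕ.* q)) ⟨
        N ×ℕ (N′ ×ℕ r) + k ×ℕ 1# ∎)))
      where
      N′ = suc b′
      -- After scaling r and r′ by N N′, this shift cancels the negative parts of both, so that only
      -- natural multiples of `1#` are compared.
      k = N ℕ.* q′ ℕ.+ N′ ℕ.* q

      clear : ∀ m n s u v → n ×ℕ s + v ×ℕ 1# ≈ u ×ℕ 1# →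
              m ×ℕ (n ×ℕ s) + (m ℕ.* v) ×ℕ 1# ≈ (m ℕ.* u) ×ℕ 1#
      clear m n s u v eq = begin-equality
        m ×ℕ (n ×ℕ s) + (m ℕ.* v) ×ℕ 1#   ≈⟨ +-congˡ (×-assocˡ 1# m v) ⟨
        m ×ℕ (n ×ℕ s) + m ×ℕ (v ×ℕ 1#)    ≈⟨ ×-distrib-+ _ _ m ⟨
        m ×ℕ (n ×ℕ s + v ×ℕ 1#)           ≈⟨ ×-congʳ m eq ⟩
        m ×ℕ (u ×ℕ 1#)                    ≈⟨ ×-assocˡ 1# m u ⟩
        (m ℕ.* u) ×ℕ 1#                   ∎

      2^-* : ∀ m n → 2# ^ (m ℕ.* n) ≈ (2# ^ n) ^ m
      2^-* m n = trans (reflexive (≡.cong (2# ^_) (ℕ.*-comm m n))) (sym (^-assocʳ 2# n m))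

      2^-split : ∀ m u n v → 2# ^ (m ℕ.* u ℕ.+ n ℕ.* v) ≈ (2# ^ u) ^ m * (2# ^ v) ^ n
      2^-split m u n v = trans (^-homo-* 2# (m ℕ.* u) (n ℕ.* v)) (*-cong (2^-* m u) (2^-* n v))

      x^NN′ : (x ^ N′) ^ N ≈ (x ^ N) ^ N′
      x^NN′ = begin-equality
        (x ^ N′) ^ N    ≈⟨ ^-assocʳ x N′ N ⟩
        x ^ (N′ ℕ.* N)  ≡⟨ ≡.cong (x ^_) (ℕ.*-comm N′ N) ⟩
        x ^ (N ℕ.* N′)  ≈⟨ ^-assocʳ x N N′ ⟨
        (x ^ N) ^ N′    ∎

      exponents : 2# ^ (N ℕ.* p′ ℕ.+ N′ ℕ.* q) ≤ 2# ^ (N ℕ.* q′ ℕ.+ N′ ℕ.* p)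
      exponents = begin
        2# ^ (N ℕ.* p′ ℕ.+ N′ ℕ.* q)
          ≈⟨ 2^-split N p′ N′ q ⟩
        (2# ^ p′) ^ N * (2# ^ q) ^ N′
          ≤⟨ *-monoˡ-≤ _ (^-nonneg N′ (^-nonneg q 0≤2)) (^-monoˡ-≤ N (^-nonneg p′ 0≤2) 2^p′≤) ⟩
        (2# ^ q′ * x ^ N′) ^ N * (2# ^ q) ^ N′
          ≈⟨ *-congʳ (trans (^-distrib-* _ _ N) (*-congˡ x^NN′)) ⟩
        (2# ^ q′) ^ N * (x ^ N) ^ N′ * (2# ^ q) ^ N′
          ≈⟨ *-assoc _ _ _ ⟩
        (2# ^ q′) ^ N * ((x ^ N) ^ N′ * (2# ^ q) ^ N′)
          ≈⟨ *-congˡ (trans (*-comm _ _) (sym (^-distrib-* _ _ N′))) ⟩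
        (2# ^ q′) ^ N * (2# ^ q * x ^ N) ^ N′
          ≤⟨ *-monoʳ-≤ _ (^-nonneg N (^-nonneg q′ 0≤2))
               (^-monoˡ-≤ N′ (*-nonneg (^-nonneg q 0≤2) (^-nonneg N (proj₁ 0<x))) ≤2^p) ⟩
        (2# ^ q′) ^ N * (2# ^ p) ^ N′
          ≈⟨ 2^-split N q′ N′ p ⟨
        2# ^ (N ℕ.* q′ ℕ.+ N′ ℕ.* p) ∎

  -- Descend from an exponent whose power of two exceeds `t` until the next lower power no longer
  -- does; `1# ≤ t` closes the case of exponent zero.
  2^-bracket : ∀ {t} → 1# ≤ t → ∃ λ p → 2# ^ p ≤ t × t ≤ 2# ^ suc p
  2^-bracket {t} 1≤t with n , t≤2^n ← 2^-bound t = go n t≤2^n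
    where
    go : ∀ k → t ≤ 2# ^ k → ∃ λ p → 2# ^ p ≤ t × t ≤ 2# ^ suc p
    go zero    t≤1 = 0 , 1≤t , ≤-trans t≤1 (1≤2^ 1)
    go (suc k) t≤  with total t (2# ^ k)
    ... | inj₁ t≤2^k = go k t≤2^k
    ... | inj₂ 2^k≤t = k , 2^k≤t , t≤

  1≤^ : ∀ {x} n → 1# ≤ x → 1# ≤ x ^ n
  1≤^ {x} zero    1≤x = ≤-refl
  1≤^ {x} (suc n) 1≤x = begin
    1#         ≈⟨ *-identityˡ 1# ⟨
    1# * 1#    ≤⟨ *-mono-≤ 0≤1 (≤-trans 0≤1 1≤x) 1≤x (1≤^ n 1≤x) ⟩
    x * x ^ n  ∎

  -- For small `x` the power `x ^ n` may lie below `1#`. With c chosen so that the inverse of `x` is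
  -- at most `2# ^ c`, the factor `2# ^ q` for q = c n lifts it to at least `1#`, where `2^-bracket`
  -- applies.
  dyadic-bracket : ∀ {x} → 0# < x → ∀ n → ∃ λ p → ∃ λ q →
                   2# ^ p ≤ 2# ^ q * x ^ n × 2# ^ q * x ^ n ≤ 2# ^ suc p
  dyadic-bracket {x} (0≤x , 0≉x) n
    with x⁻¹ , xx⁻¹≈1 ← inverse x (λ x≈0 → 0≉x (sym x≈0))
    with c , x⁻¹≤2^c ← 2^-bound x⁻¹
    = proj₁ bracket , c ℕ.* n , proj₂ bracket
    where
    1≤2^c*x : 1# ≤ 2# ^ c * x
    1≤2^c*x = begin
      1#           ≈⟨ xx⁻¹≈1 ⟨
      x * x⁻¹      ≤⟨ *-monoʳ-≤ x 0≤x x⁻¹≤2^c ⟩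
      x * 2# ^ c   ≈⟨ *-comm _ _ ⟩
      2# ^ c * x   ∎
    bracket = 2^-bracket {2# ^ (c ℕ.* n) * x ^ n} (begin
      1#                      ≤⟨ 1≤^ n 1≤2^c*x ⟩
      (2# ^ c * x) ^ n        ≈⟨ ^-distrib-* _ _ n ⟩
      (2# ^ c) ^ n * x ^ n    ≈⟨ *-congʳ (^-assocʳ 2# c n) ⟩
      2# ^ (c ℕ.* n) * x ^ n  ∎)

  -- For every N, the numbers N log₂ (x y) and N (log₂ x + log₂ y) lie, up to the
  -- same shift q + q′, between p + p′ and p + p′ + 2.
  log₂-*-bracket : ∀ {x y} → 0# < x → 0# < y → ∀ b → ∃ λ l → ∃ λ k →
    let N = suc b; u = log₂ (x * y); v = log₂ x + log₂ y in
    (l ≤ N ×ℕ u + k × N ×ℕ u + k ≤ 2# + l) × (l ≤ N ×ℕ v + k × N ×ℕ v + k ≤ 2# + l)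
  log₂-*-bracket {x} {y} 0<x 0<y b
    with p  , q  , p≤  , ≤p  ← dyadic-bracket 0<x (suc b)
    with p′ , q′ , p′≤ , ≤p′ ← dyadic-bracket 0<y (suc b)
    = (p ℕ.+ p′) ×ℕ 1# , (q ℕ.+ q′) ×ℕ 1#
    , ( log₂-lower b (p ℕ.+ p′) (q ℕ.+ q′) 0<xy (begin
          2# ^ (p ℕ.+ p′)  ≈⟨ ^-homo-* 2# p p′ ⟩
          2# ^ p * 2# ^ p′ ≤⟨ *-mono-≤ (^-nonneg p′ 0≤2) (*-nonneg (^-nonneg q 0≤2) (^-nonneg N (proj₁ 0<x))) p≤ p′≤ ⟩
          2# ^ q * x ^ N * (2# ^ q′ * y ^ N) ≈⟨ powers ⟨
          2# ^ (q ℕ.+ q′) * (x * y) ^ N ∎)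
      , (begin
          N ×ℕ log₂ (x * y) + (q ℕ.+ q′) ×ℕ 1#
            ≤⟨ log₂-upper b (suc p ℕ.+ suc p′) (q ℕ.+ q′) 0<xy (begin
                 2# ^ (q ℕ.+ q′) * (x * y) ^ N       ≈⟨ powers ⟩
                 2# ^ q * x ^ N * (2# ^ q′ * y ^ N)
                   ≤⟨ *-mono-≤ (*-nonneg (^-nonneg q′ 0≤2) (^-nonneg N (proj₁ 0<y)))
                               (^-nonneg (suc p) 0≤2) ≤p ≤p′ ⟩
                 2# ^ suc p * 2# ^ suc p′            ≈⟨ ^-homo-* 2# (suc p) (suc p′) ⟨
                 2# ^ (suc p ℕ.+ suc p′)             ∎) ⟩
          (suc p ℕ.+ suc p′) ×ℕ 1#              ≈⟨ ×-homo-+ 1# (suc p) (suc p′) ⟩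
          suc p ×ℕ 1# + suc p′ ×ℕ 1#            ≈⟨ sucs ⟩
          2# + (p ℕ.+ p′) ×ℕ 1#                 ∎))
    , ( (begin
          (p ℕ.+ p′) ×ℕ 1#                      ≈⟨ ×-homo-+ 1# p p′ ⟩
          p ×ℕ 1# + p′ ×ℕ 1#                    ≤⟨ +-mono-≤ (log₂-lower b p q 0<x p≤) (log₂-lower b p′ q′ 0<y p′≤) ⟩
          N ×ℕ log₂ x + q ×ℕ 1# + (N ×ℕ log₂ y + q′ ×ℕ 1#) ≈⟨ logs ⟨
          N ×ℕ (log₂ x + log₂ y) + (q ℕ.+ q′) ×ℕ 1#        ∎)
      , (begin
          N ×ℕ (log₂ x + log₂ y) + (q ℕ.+ q′) ×ℕ 1#        ≈⟨ logs ⟩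
          N ×ℕ log₂ x + q ×ℕ 1# + (N ×ℕ log₂ y + q′ ×ℕ 1#)
            ≤⟨ +-mono-≤ (log₂-upper b (suc p) q 0<x ≤p) (log₂-upper b (suc p′) q′ 0<y ≤p′) ⟩
          suc p ×ℕ 1# + suc p′ ×ℕ 1#            ≈⟨ sucs ⟩
          2# + (p ℕ.+ p′) ×ℕ 1#                 ∎))
    where
    N = suc b
    0<xy = *-pos 0<x 0<y
    powers : 2# ^ (q ℕ.+ q′) * (x * y) ^ N ≈ 2# ^ q * x ^ N * (2# ^ q′ * y ^ N)
    powers = trans (*-cong (^-homo-* 2# q q′) (^-distrib-* x y N)) (*-interchange _ _ _ _)
    logs : N ×ℕ (log₂ x + log₂ y) + (q ℕ.+ q′) ×ℕ 1#
           ≈ N ×ℕ log₂ x + q ×ℕ 1# + (N ×ℕ log₂ y + q′ ×ℕ 1#)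
    logs = trans (+-cong (×-distrib-+ _ _ N) (×-homo-+ 1# q q′)) (+-interchange _ _ _ _)
    sucs : suc p ×ℕ 1# + suc p′ ×ℕ 1# ≈ 2# + (p ℕ.+ p′) ×ℕ 1#
    sucs = trans (+-interchange _ _ _ _) (+-congˡ (sym (×-homo-+ 1# p p′)))

  -- For every N, the N-fold multiples of both sides lie in a common interval of length two, so the
  -- sides differ by at most 2 / N.
  log₂-* : ∀ {x y} → 0# < x → 0# < y → log₂ (x * y) ≈ log₂ x + log₂ y
  log₂-* {x} {y} 0<x 0<y = antisym
    (×ℕ-≤-archimedean λ b → let l , k , (_ , u≤) , (≤v , _) = log₂-*-bracket 0<x 0<y b in
      compare _ _ k l u≤ ≤v)
    (×ℕ-≤-archimedean λ b → let l , k , (≤u , _) , (_ , v≤) = log₂-*-bracket 0<x 0<y b in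
      compare _ _ k l v≤ ≤u)
    where
    compare : ∀ s t k l → s + k ≤ 2# + l → l ≤ t + k → s ≤ t + 2#
    compare s t k l s≤ ≤t = +-cancelʳ-≤ k (begin
      s + k         ≤⟨ s≤ ⟩
      2# + l        ≤⟨ +-monoʳ-≤ 2# ≤t ⟩
      2# + (t + k)  ≈⟨ +-assoc _ _ _ ⟨
      2# + t + k    ≈⟨ +-congʳ (+-comm _ _) ⟩
      t + 2# + k    ∎)

-- Sums, maxima and minima over finite sets.

module FiniteAggregates {c ℓ} (ℝ : CompleteOrderedField c ℓ) where
  open CompleteOrderedField ℝ
  open OrderedFieldProperties orderedField
  open Order orderedField
  open Leakage ℝ
  open import Relation.Binary.Reasoning.PartialOrder poset
  open import Algebra.Construct.NaturalChoice.Max totalOrder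
    using (⊔-sel; x≤x⊔y; x≤y⊔x)
  open import Algebra.Construct.NaturalChoice.Min totalOrder
    using (⊓-sel; x⊓y≤x; x⊓y≤y)
  open import Algebra.Properties.Semiring.Sum semiring
    using (∑-comm; *-distribʳ-sum; sum-replicate-zero)

  sum-mono-≤ : ∀ {n} {f h : Fin n → Carrier} → (∀ i → f i ≤ h i) → sum f ≤ sum h
  sum-mono-≤ {zero}  f≤h = ≤-refl
  sum-mono-≤ {suc n} f≤h = +-mono-≤ (f≤h zero) (sum-mono-≤ (f≤h ∘ suc))

  sum-nonneg : ∀ {n} {f : Fin n → Carrier} → (∀ i → 0# ≤ f i) → 0# ≤ sum f
  sum-nonneg {zero}  0≤f = ≤-refl
  sum-nonneg {suc n} 0≤f = +-nonneg (0≤f zero) (sum-nonneg (0≤f ∘ suc))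

  -- Expanding the product of the sums gives the diagonal terms on the left and cross terms, which
  -- are nonnegative.
  sum-*-≤ : ∀ {n} {f h : Fin n → Carrier} → (∀ i → 0# ≤ f i) → (∀ i → 0# ≤ h i) →
            sum (λ i → f i * h i) ≤ sum f * sum h
  sum-*-≤ {zero}          0≤f 0≤h = ≤-reflexive (sym (zeroˡ 0#))
  sum-*-≤ {suc n} {f} {h} 0≤f 0≤h = begin
    f₀ * h₀ + sum (λ i → f (suc i) * h (suc i))
      ≤⟨ +-monoʳ-≤ _ (sum-*-≤ (0≤f ∘ suc) (0≤h ∘ suc)) ⟩
    f₀ * h₀ + Σf * Σh
      ≤⟨ +-mono-≤ (*-monoʳ-≤ f₀ (0≤f zero) (x≤x+y (sum-nonneg (0≤h ∘ suc))))
                  (*-monoʳ-≤ Σf (sum-nonneg (0≤f ∘ suc)) (y≤x+y (0≤h zero))) ⟩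
    f₀ * (h₀ + Σh) + Σf * (h₀ + Σh)
      ≈⟨ distribʳ _ _ _ ⟨
    (f₀ + Σf) * (h₀ + Σh) ∎
    where
    f₀ = f zero
    h₀ = h zero
    Σf = sum (f ∘ suc)
    Σh = sum (h ∘ suc)

  sumOver-mono-≤ : ∀ A {f h : Element A → Carrier} → (∀ a → f a ≤ h a) → sumOver A f ≤ sumOver A h
  sumOver-mono-≤ A f≤h = sum-mono-≤ (λ i → f≤h (A at i))

  sumOver-nonneg : ∀ A {f : Element A → Carrier} → (∀ a → 0# ≤ f a) → 0# ≤ sumOver A f
  sumOver-nonneg A 0≤f = sum-nonneg (λ i → 0≤f (A at i))

  sumOver-zero : ∀ A {f : Element A → Carrier} → (∀ a → f a ≈ 0#) → sumOver A f ≈ 0#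
  sumOver-zero A f≈0 = trans (sumOver-cong A f≈0) (sum-replicate-zero (suc (FiniteSet.predSize A)))

  *-distribʳ-sumOver : ∀ A x (f : Element A → Carrier) → sumOver A f * x ≈ ∑[ a ∈ A ] (f a * x)
  *-distribʳ-sumOver A x f = *-distribʳ-sum x (λ i → f (A at i))

  sumOver-*-≤ : ∀ A {f h : Element A → Carrier} → (∀ a → 0# ≤ f a) → (∀ a → 0# ≤ h a) →
                ∑[ a ∈ A ] (f a * h a) ≤ sumOver A f * sumOver A h
  sumOver-*-≤ A 0≤f 0≤h = sum-*-≤ (λ i → 0≤f (A at i)) (λ i → 0≤h (A at i))

  sumOver-comm : ∀ A B (f : Element A → Element B → Carrier) →
                 (∑[ a ∈ A ] ∑[ b ∈ B ] f a b) ≈ ∑[ b ∈ B ] ∑[ a ∈ A ] f a b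
  sumOver-comm A B f = ∑-comm (λ i j → f (A at i) (B at j))

  at-surjective : ∀ A (a : Element A) → ∃ λ i → A at i ≡ a
  at-surjective A a = Inverse.from (FiniteSet.enum A) a , Inverse.strictlyInverseˡ (FiniteSet.enum A) a

  foldr-max-attained : ∀ {n} x (f : Fin n → Carrier) →
                       Vector.foldr max x f ≈ x ⊎ ∃ λ i → Vector.foldr max x f ≈ f i
  foldr-max-attained {zero}  x f = inj₁ refl
  foldr-max-attained {suc n} x f with ⊔-sel (f zero) (Vector.foldr max x (f ∘ suc))
  ... | inj₁ eq = inj₂ (zero , eq)
  ... | inj₂ eq with foldr-max-attained x (f ∘ suc)
  ...   | inj₁ eq′       = inj₁ (trans eq eq′)
  ...   | inj₂ (i , eq′) = inj₂ (suc i , trans eq eq′)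

  x≤foldr-max : ∀ {n} x (f : Fin n → Carrier) → x ≤ Vector.foldr max x f
  x≤foldr-max {zero}  x f = ≤-refl
  x≤foldr-max {suc n} x f = ≤-trans (x≤foldr-max x (f ∘ suc)) (x≤y⊔x (f zero) _)

  f≤foldr-max : ∀ {n} x (f : Fin n → Carrier) i → f i ≤ Vector.foldr max x f
  f≤foldr-max x f zero    = x≤x⊔y (f zero) _
  f≤foldr-max x f (suc i) = ≤-trans (f≤foldr-max x (f ∘ suc) i) (x≤y⊔x (f zero) _)

  maxOver-attained : ∀ A (f : Element A → Carrier) → ∃ λ a → maxOver A f ≈ f a
  maxOver-attained A f with foldr-max-attained (f (A at zero)) (λ i → f (A at suc i))
  ... | inj₁ eq       = A at zero , eq
  ... | inj₂ (i , eq) = A at suc i , eq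

  ≤maxOver : ∀ A (f : Element A → Carrier) a → f a ≤ maxOver A f
  ≤maxOver A f a with at-surjective A a
  -- Index `zero` is the seed of the fold; all other indices are folded in.
  ... | zero  , ≡.refl = x≤foldr-max (f (A at zero)) (λ i → f (A at suc i))
  ... | suc i , ≡.refl = f≤foldr-max (f (A at zero)) (λ i → f (A at suc i)) i

  maxOver-mono-≤ : ∀ A {f h : Element A → Carrier} → (∀ a → f a ≤ h a) → maxOver A f ≤ maxOver A h
  maxOver-mono-≤ A {f} {h} f≤h with a , eq ← maxOver-attained A f =
    ≤-trans (≤-reflexive eq) (≤-trans (f≤h a) (≤maxOver A h a))

  maxOver-nonneg : ∀ A {f : Element A → Carrier} → (∀ a → 0# ≤ f a) → 0# ≤ maxOver A f
  maxOver-nonneg A {f} 0≤f = ≤-trans (0≤f (A at zero)) (≤maxOver A f (A at zero))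

  minimum-≤ : ∀ {v xs} → v ∈ xs → minimum xs ≤ v
  minimum-≤ {xs = x ∷ xs} = λ { (here ≡.refl) → foldr-min≤x xs ; (there v∈xs) → foldr-min≤ v∈xs }
    where
    foldr-min≤x : ∀ xs → List.foldr min x xs ≤ x
    foldr-min≤x []       = ≤-refl
    foldr-min≤x (y ∷ ys) = ≤-trans (x⊓y≤y y _) (foldr-min≤x ys)
    foldr-min≤ : ∀ {v xs} → v ∈ xs → List.foldr min x xs ≤ v
    foldr-min≤ {xs = y ∷ ys} (here ≡.refl) = x⊓y≤x y _
    foldr-min≤ {xs = y ∷ ys} (there v∈ys)  = ≤-trans (x⊓y≤y y _) (foldr-min≤ v∈ys)

  -- The membership hypothesis excludes the empty list, whose minimum is `0#` by convention.
  minimum-pos : ∀ {v xs} → v ∈ xs → (∀ {u} → u ∈ xs → 0# < u) → 0# < minimum xs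
  minimum-pos {xs = x ∷ xs} _ 0< = foldr-min-pos xs (0< ∘ there)
    where
    foldr-min-pos : ∀ ys → (∀ {u} → u ∈ ys → 0# < u) → 0# < List.foldr min x ys
    foldr-min-pos []       0<ys = 0< (here ≡.refl)
    foldr-min-pos (y ∷ ys) 0<ys with ⊓-sel y (List.foldr min x ys)
    ... | inj₁ eq = 0<-respʳ-≈ (sym eq) (0<ys (here ≡.refl))
    ... | inj₂ eq = 0<-respʳ-≈ (sym eq) (foldr-min-pos ys (0<ys ∘ there))

  ∈-elements : ∀ A a → a ∈ elements A
  ∈-elements A a with i , ≡.refl ← at-surjective A a = ∈-tabulate⁺ {f = A at_} i

-- Vulnerabilities and the leakage inequality.

module LeakageProperties {c ℓ} (ℝ : CompleteOrderedField c ℓ) where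
  open CompleteOrderedField ℝ
  open OrderedFieldProperties orderedField
  open Order orderedField
  open Logarithm ℝ using (log₂)
  open LogarithmProperties ℝ using (log₂-mono-≤; log₂-*)
  open FiniteAggregates ℝ
  open Leakage ℝ
  open Prior
  open Channel
  open GainFunction
  open import Relation.Binary.Reasoning.PartialOrder poset
  open import Algebra.Properties.CommutativeSemigroup *-commutativeSemigroup
    using (xy∙z≈xz∙y)
  open import Algebra.Properties.Ring ring using (-‿involutive)

  module _ {W X : FiniteSet} (g : GainFunction W X) (π : Prior X) where

    weight : Element W → Element X → Carrier
    weight w x = prob π x * gain g w x

    weights : List Carrier
    weights = List.cartesianProductWith (λ x w → weight w x) (elements X) (elements W)

    -- Hᵐⁱⁿ g π is definitionally - log₂ minWeight.
    minWeight : Carrier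
    minWeight = minimum (List.filter (λ v → ¬? (v ≟ 0#)) weights)

    weight-nonneg : ∀ w x → 0# ≤ weight w x
    weight-nonneg w x = *-nonneg (nonneg π x) (nonneg g w x)

    weight∈ : ∀ w x → ¬ (weight w x ≈ 0#) →
              weight w x ∈ List.filter (λ v → ¬? (v ≟ 0#)) weights
    weight∈ w x = ∈-filter⁺ (λ v → ¬? (v ≟ 0#))
      (∈-cartesianProductWith⁺ (λ x w → weight w x) (∈-elements X x) (∈-elements W w))

    minWeight-pos : ∀ {w x} → ¬ (weight w x ≈ 0#) → 0# < minWeight
    minWeight-pos {w} {x} a≉0 = minimum-pos (weight∈ w x a≉0) positive
      where
      positive : ∀ {u} → u ∈ List.filter (λ v → ¬? (v ≟ 0#)) weights → 0# < u
      positive u∈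
        with u∈weights , u≉0 ← ∈-filter⁻ (λ v → ¬? (v ≟ 0#)) {xs = weights} u∈
        with x , w , _ , _ , ≡.refl ← ∈-cartesianProductWith⁻ (λ x w → weight w x) (elements X) (elements W) u∈weights
        = weight-nonneg w x , λ 0≈u → u≉0 (sym 0≈u)

    -- A single nonzero weight makes `minWeight` positive. If it were not positive, all weights
    -- would vanish, and `V` with them.
    0<V⇒0<minWeight : 0# < V g π → 0# < minWeight
    0<V⇒0<minWeight (0≤V , 0≉V) with 0# <? minWeight
    ... | yes 0<μ = 0<μ
    ... | no  0≮μ = contradiction (sym V≈0) 0≉V
      where
      weight≈0 : ∀ w x → weight w x ≈ 0#
      weight≈0 w x with weight w x ≟ 0#
      ... | yes a≈0 = a≈0
      ... | no  a≉0 = contradiction (minWeight-pos a≉0) 0≮μ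
      V≈0 : V g π ≈ 0#
      V≈0 with w , eq ← maxOver-attained W (λ w → ∑[ x ∈ X ] weight w x) =
        trans eq (sumOver-zero X (weight≈0 w))

    weight*minWeight≤weight² : ∀ w x → weight w x * minWeight ≤ weight w x * weight w x
    weight*minWeight≤weight² w x with weight w x ≟ 0#
    ... | yes a≈0 = ≤-reflexive (trans (annihilate _) (sym (annihilate _)))
      where
      annihilate : ∀ v → weight w x * v ≈ 0#
      annihilate v = trans (*-congʳ a≈0) (zeroˡ v)
    ... | no  a≉0 = *-monoʳ-≤ _ (weight-nonneg w x) (minimum-≤ (weight∈ w x a≉0))

    -- Posterior vulnerability of a single channel.

    module _ {Y : FiniteSet} (C : Channel X Y) where

      -- The expected gain of `w` restricted to the event that `y` is output, not divided by the
      -- probability of that event.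
      joint : Element W → Element Y → Carrier
      joint w y = ∑[ x ∈ X ] (prob π x * entry C x y * gain g w x)

      joint-summand-nonneg : ∀ w y x → 0# ≤ prob π x * entry C x y * gain g w x
      joint-summand-nonneg w y x = *-nonneg (*-nonneg (nonneg π x) (nonneg C x y)) (nonneg g w x)

      maxJoint : Element Y → Carrier
      maxJoint y = max[ w ∈ W ] joint w y

      maxJoint-nonneg : ∀ y → 0# ≤ maxJoint y
      maxJoint-nonneg y = maxOver-nonneg W λ w → sumOver-nonneg X (joint-summand-nonneg w y)

      -- The action optimal for the prior may be taken whatever the output is, and its gain splits
      -- over the outputs because the rows of `C` sum to `1#`. In particular posterior
      -- vulnerabilities are positive, so their logarithms are genuine.
      V≤posteriorV : V g π ≤ posteriorV g π C
      V≤posteriorV with w , eq ← maxOver-attained W (λ w → ∑[ x ∈ X ] weight w x) = begin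
        V g π
          ≈⟨ eq ⟩
        (∑[ x ∈ X ] weight w x)
          ≈⟨ sumOver-cong X (λ x → begin-equality
               weight w x
                 ≈⟨ *-identityʳ _ ⟨
               weight w x * 1#
                 ≈⟨ *-congˡ (normalised C x) ⟨
               weight w x * (∑[ y ∈ Y ] entry C x y)
                 ≈⟨ *-distribˡ-sumOver Y (weight w x) (entry C x) ⟩
               (∑[ y ∈ Y ] (weight w x * entry C x y))
                 ≈⟨ sumOver-cong Y (λ y → xy∙z≈xz∙y (prob π x) (gain g w x) (entry C x y)) ⟩
               (∑[ y ∈ Y ] (prob π x * entry C x y * gain g w x)) ∎) ⟩
        (∑[ x ∈ X ] ∑[ y ∈ Y ] (prob π x * entry C x y * gain g w x))
          ≈⟨ sumOver-comm X Y (λ x y → prob π x * entry C x y * gain g w x) ⟩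
        (∑[ y ∈ Y ] joint w y)
          ≤⟨ sumOver-mono-≤ Y (λ y → ≤maxOver W (λ w → joint w y) w) ⟩
        posteriorV g π C ∎

      I≈log₂-ratio : I g π C ≈ log₂ (posteriorV g π C) - log₂ (V g π)
      I≈log₂-ratio = trans (+-congˡ (-‿involutive _)) (+-comm _ _)

    -- `E` is any channel whose entries are the products, so that in the induction it can be the
    -- composition of all channels, with `C` the first one and `D` the composition of the others.
    module _ {Y Z : FiniteSet} (C : Channel X Y) (D : Channel X Z) (E : Channel X (Y ×ᶠ Z))
             (entry-× : ∀ x y z → entry E x (y , z) ≈ entry C x y * entry D x z) where

      -- The factor `minWeight` is traded for a second copy of the weight, so that `C` and `D`
      -- receive one each; the sum of products is then at most the product of sums.
      joint-× : ∀ w y z → joint E w (y , z) * minWeight ≤ joint C w y * joint D w z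
      joint-× w y z = begin
        joint E w (y , z) * minWeight
          ≈⟨ *-distribʳ-sumOver X minWeight (λ x → prob π x * entry E x (y , z) * gain g w x) ⟩
        (∑[ x ∈ X ] (prob π x * entry E x (y , z) * gain g w x * minWeight))
          ≤⟨ sumOver-mono-≤ X (λ x → summand x) ⟩
        (∑[ x ∈ X ] (prob π x * entry C x y * gain g w x * (prob π x * entry D x z * gain g w x)))
          ≤⟨ sumOver-*-≤ X (joint-summand-nonneg C w y) (joint-summand-nonneg D w z) ⟩
        joint C w y * joint D w z ∎
        where
        summand : ∀ x → prob π x * entry E x (y , z) * gain g w x * minWeight
                  ≤ prob π x * entry C x y * gain g w x * (prob π x * entry D x z * gain g w x)
        summand x = begin
          prob π x * entry E x (y , z) * gain g w x * minWeight
            ≈⟨ *-congʳ (trans (xy∙z≈xz∙y _ _ _) (*-congˡ (entry-× x y z))) ⟩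
          weight w x * (entry C x y * entry D x z) * minWeight
            ≈⟨ xy∙z≈xz∙y _ _ _ ⟩
          weight w x * minWeight * (entry C x y * entry D x z)
            ≤⟨ *-monoˡ-≤ _ (*-nonneg (nonneg C x y) (nonneg D x z)) (weight*minWeight≤weight² w x) ⟩
          weight w x * weight w x * (entry C x y * entry D x z)
            ≈⟨ *-interchange _ _ _ _ ⟩
          weight w x * entry C x y * (weight w x * entry D x z)
            ≈⟨ *-cong (xy∙z≈xz∙y _ _ _) (xy∙z≈xz∙y _ _ _) ⟩
          prob π x * entry C x y * gain g w x * (prob π x * entry D x z * gain g w x) ∎

      -- A maximiser for the pair of outputs is a candidate action for each output separately.
      maxJoint-× : ∀ y z → maxJoint E (y , z) * minWeight
                    ≤ maxJoint C y * maxJoint D z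
      maxJoint-× y z with w , eq ← maxOver-attained W (λ w → joint E w (y , z)) = begin
        maxJoint E (y , z) * minWeight
          ≈⟨ *-congʳ eq ⟩
        joint E w (y , z) * minWeight
          ≤⟨ joint-× w y z ⟩
        joint C w y * joint D w z
          ≤⟨ *-mono-≤ (sumOver-nonneg X (joint-summand-nonneg D w z)) (maxJoint-nonneg C y)
               (≤maxOver W (λ w → joint C w y) w) (≤maxOver W (λ w → joint D w z) w) ⟩
        maxJoint C y * maxJoint D z ∎

      -- Sum the bound for the maxima over all pairs of outputs; on the right the double sum
      -- factorises.
      posteriorV-× : posteriorV g π E * minWeight ≤ posteriorV g π C * posteriorV g π D
      posteriorV-× = begin
        posteriorV g π E * minWeight
          ≈⟨ *-congʳ (sumOver-× Y Z (maxJoint E)) ⟩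
        (∑[ y ∈ Y ] ∑[ z ∈ Z ] maxJoint E (y , z)) * minWeight
          ≈⟨ *-distribʳ-sumOver Y minWeight (λ y → ∑[ z ∈ Z ] maxJoint E (y , z)) ⟩
        (∑[ y ∈ Y ] ((∑[ z ∈ Z ] maxJoint E (y , z)) * minWeight))
          ≈⟨ sumOver-cong Y (λ y → *-distribʳ-sumOver Z minWeight (λ z → maxJoint E (y , z))) ⟩
        (∑[ y ∈ Y ] ∑[ z ∈ Z ] (maxJoint E (y , z) * minWeight))
          ≤⟨ sumOver-mono-≤ Y (λ y → sumOver-mono-≤ Z (maxJoint-× y)) ⟩
        (∑[ y ∈ Y ] ∑[ z ∈ Z ] (maxJoint C y * maxJoint D z))
          ≈⟨ sumOver-cong Y (λ y → *-distribˡ-sumOver Z (maxJoint C y) (maxJoint D)) ⟨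
        (∑[ y ∈ Y ] (maxJoint C y * posteriorV g π D))
          ≈⟨ *-distribʳ-sumOver Y (posteriorV g π D) (maxJoint C) ⟨
        posteriorV g π C * posteriorV g π D ∎

      I-× : 0# < V g π → I g π E ≤ I g π C + (I g π D + (Hᵐⁱⁿ g π - H g π))
      I-× 0<V = begin
        I g π E                        ≈⟨ I≈log₂-ratio E ⟩
        log₂ (posteriorV g π E) - v    ≤⟨ +-monoˡ-≤ (- v) log₂-E ⟩
        (c′ + (d - m)) - v             ≈⟨ +-assoc _ _ _ ⟩
        c′ + ((d - m) - v)             ≈⟨ +-congˡ (+-comm _ _) ⟩
        c′ + (- v + (d - m))           ≈⟨ +-assoc _ _ _ ⟨
        -- Inserting `v` splits `d - m` into the leakage of `D` and the correction term.
        (c′ - v) + (d - m)             ≈⟨ +-congˡ ([x-y]+[y-z]≈x-z d v m) ⟨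
        (c′ - v) + ((d - v) + (v - m)) ≈⟨ +-cong (I≈log₂-ratio C) (+-cong (I≈log₂-ratio D) swap) ⟨
        I g π C + (I g π D + (Hᵐⁱⁿ g π - H g π)) ∎
        where
        v = log₂ (V g π)
        c′ = log₂ (posteriorV g π C)
        d = log₂ (posteriorV g π D)
        m = log₂ minWeight
        0<μ = 0<V⇒0<minWeight 0<V
        0<posteriorV : ∀ {Y} (C : Channel X Y) → 0# < posteriorV g π C
        0<posteriorV C = 0<-≤-trans 0<V (V≤posteriorV C)
        swap : Hᵐⁱⁿ g π - H g π ≈ v - m
        swap = trans (+-congˡ (-‿involutive _)) (+-comm _ _)
        log₂-E : log₂ (posteriorV g π E) ≤ c′ + (d - m)
        log₂-E = +-cancelʳ-≤ m (begin
          log₂ (posteriorV g π E) + m                  ≈⟨ log₂-* (0<posteriorV E) 0<μ ⟨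
          log₂ (posteriorV g π E * minWeight)          ≤⟨ log₂-mono-≤ (*-pos (0<posteriorV E) 0<μ) posteriorV-× ⟩
          log₂ (posteriorV g π C * posteriorV g π D)   ≈⟨ log₂-* (0<posteriorV C) (0<posteriorV D) ⟩
          c′ + d                                       ≈⟨ +-congˡ (x-y+y≈x d m) ⟨
          c′ + ((d - m) + m)                           ≈⟨ +-assoc _ _ _ ⟨
          c′ + (d - m) + m                             ∎)

    -- Induction on the number of channels.

    joint-cong : ∀ {Y Z} (C : Channel X Y) (D : Channel X Z) w y z →
                 (∀ x → entry C x y ≈ entry D x z) → joint C w y ≈ joint D w z
    joint-cong C D w y z C≈D = sumOver-cong X
      {λ x → prob π x * entry C x y * gain g w x} {λ x → prob π x * entry D x z * gain g w x}
      (λ x → *-congʳ (*-congˡ (C≈D x)))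

    -- A composition of one channel is not literally that channel: its outputs are pairs with `tt`,
    -- and its entries carry a factor `1#`.
    I-∥-single : 0# < V g π → {Y : Fin 1 → FiniteSet} (C : ∀ i → Channel X (Y i)) →
                 I g π (∥ C) ≤ I g π (C zero)
    I-∥-single 0<V {Y} C = begin
      I g π (∥ C)                                        ≈⟨ I≈log₂-ratio (∥ C) ⟩
      log₂ (posteriorV g π (∥ C)) - log₂ (V g π)         ≤⟨ +-monoˡ-≤ _
        (log₂-mono-≤ (0<-≤-trans 0<V (V≤posteriorV (∥ C))) posteriorV-∥≤) ⟩
      log₂ (posteriorV g π (C zero)) - log₂ (V g π)      ≈⟨ I≈log₂-ratio (C zero) ⟨
      I g π (C zero)                                     ∎
      where
      posteriorV-∥≤ : posteriorV g π (∥ C) ≤ posteriorV g π (C zero)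
      posteriorV-∥≤ = begin
        posteriorV g π (∥ C)
          ≈⟨ sumOver-× (Y zero) (Πᶠ (Y ∘ suc)) (maxJoint (∥ C)) ⟩
        -- The inner sum runs over the single tuple `tt`, hence the trailing `0#`.
        (∑[ y ∈ Y zero ] (maxJoint (∥ C) (y , tt) + 0#))
          ≤⟨ sumOver-mono-≤ (Y zero) {h = maxJoint (C zero)} (λ y →
               ≤-trans (≤-reflexive (+-identityʳ _)) (maxOver-mono-≤ W λ w →
                 ≤-reflexive (joint-cong (∥ C) (C zero) w (y , tt) y λ x → *-identityʳ _))) ⟩
        posteriorV g π (C zero) ∎

    -- Splitting off the first channel costs one correction term. With m + 1 channels this happens m
    -- times, and the last remaining channel costs nothing.
    I-∥ : 0# < V g π → ∀ m {Y : Fin (suc m) → FiniteSet} (C : ∀ i → Channel X (Y i)) →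
          I g π (∥ C) ≤ sum (λ i → I g π (C i)) + m ×ℕ (Hᵐⁱⁿ g π - H g π)
    I-∥ 0<V zero    C = begin
      I g π (∥ C)               ≤⟨ I-∥-single 0<V C ⟩
      I g π (C zero)            ≈⟨ +-identityʳ _ ⟨
      I g π (C zero) + 0#       ≈⟨ +-identityʳ _ ⟨
      I g π (C zero) + 0# + 0#  ∎
    I-∥ 0<V (suc m) C = begin
      I g π (∥ C)
        -- By definition, an entry of the composition is the entry of the first channel times that
        -- of the rest, so `refl` proves the product condition.
        ≤⟨ I-× (C zero) (∥ (C ∘ suc)) (∥ C) (λ _ _ _ → refl) 0<V ⟩
      I₀ + (I g π (∥ (C ∘ suc)) + K)
        ≤⟨ +-monoʳ-≤ I₀ (+-monoˡ-≤ K (I-∥ 0<V m (C ∘ suc))) ⟩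
      I₀ + ((S + m ×ℕ K) + K)
        ≈⟨ +-congˡ (trans (+-assoc _ _ _) (+-congˡ (+-comm _ _))) ⟩
      I₀ + (S + suc m ×ℕ K)
        ≈⟨ +-assoc _ _ _ ⟨
      I₀ + S + suc m ×ℕ K ∎
      where
      I₀ = I g π (C zero)
      K = Hᵐⁱⁿ g π - H g π
      S = sum (λ i → I g π (C (suc i)))

proposition3p18 : ∀ {c ℓ} (ℝ : CompleteOrderedField c ℓ) →
    let open CompleteOrderedField ℝ
        open Leakage ℝ in
    (n : ℕ) .{{_ : NonZero n}} →
    (X W : FiniteSet) (Y : Fin n → FiniteSet)
    (g : GainFunction W X) (π : Prior X) →
    0# < V g π →
    (C : ∀ i → Channel X (Y i)) →
    I g π (∥ C) ≤ sum (λ i → I g π (C i)) + pred n ×ℕ (Hᵐⁱⁿ g π - H g π)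
proposition3p18 ℝ (suc m) X W Y g π 0<V C = LeakageProperties.I-∥ ℝ g π 0<V m C
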